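{- There is an infinite family of strings over the alphabet $\{0,1,2\}$, with a parameter $\ell=\ell(T)$ chosen for each family string $T[1,n]$ such that $\ell=o(n)$ (as $n\to\infty$ along the family), for which the number $\hat z$ of phrases in the ReLZ parsing of $T$ with prefix parameter $\ell$ and the number $z$ of phrases in the LZ parsing of $T$ satisfy $\hat z=\Omega(z\log n)$; that is, there is a constant $C>0$ such that $\hat z\ge C\,z\log n$ for all sufficiently long strings $T$ of the family.
   Context: $\log$ is base 2. $T[i]$ is the $i$th symbol of $T$, and $T[i,j]=T[i]T[i+1]\cdots T[j]$; $n=|T|$. LZ parsing. $\mathit{LZ}(T)=(P_1,\ldots,P_z)$ is the factorization $T=P_1\cdots P_z$ into non-empty phrases built greedily: if $P_1,\ldots,P_{j-1}$ parse $T[1,i-1]$, then $P_j$ is the longest prefix of $T[i,n]$ that has an occurrence in $T$ starting at a position smaller than $i$ (overlaps allowed); $P_j$ is then a copying phrase and the previous occurrence is its source. If this longest prefix is empty, $P_j=T[i]$ is a literal phrase. RLZ parsing. For a reference string $R$, $\mathit{RLZ}(T,R)=(P_1,\ldots,P_z)$ is the factorization of $T$ where $P_j$ is the longest prefix of the remaining suffix $T[i,n]$ that is a substring of $R$ (copying phrase), or, if this is empty, $P_j=T[i]$ (literal phrase). ReLZ parsing with prefix parameter $\ell$. First compute the sequence of phrases $(P_1,\ldots,P_{z'})=\mathit{LZ}(T[1,\ell])\cdot \mathit{RLZ}(T[\ell+1,n],T[1,\ell])$, so $T=P_1\cdots P_{z'}$. Regard phrases as atomic metasymbols: let $T'[1,z']$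 be a string with $T'[i]=T'[j]$ iff $P_i=P_j$. Compute $\mathit{LZ}(T')=(P'_1,\ldots,P'_{\hat z})$. The ReLZ parsing of $T$ has $\hat z$ phrases, the $j$th being the concatenation of the phrases $P_i$ covered by $P'_j$: each literal phrase $P'_j$ corresponds to a single phrase $P_i$, left unchanged, and each copying phrase $P'_j$ with source $T'[p,q]$ becomes a copying phrase of $T$ with source $T[p',q']$, $p'=|P_1\cdots P_{p-1}|+1$, $q'=|P_1\cdots P_q|$. -}

module Defs where

open import Data.Bool using (if_then_else_)
open import Data.Fin using (Fin)
import Data.Fin.Properties as Fin
open import Data.List using (List; []; _∷_; _++_; concat; drop; length; map; take)
open import Data.List.Properties using (length-drop; ≡-dec; take++drop≡id)
open import Data.List.Relation.Binary.Infix.Heterogeneous using (Infix)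
open import Data.List.Relation.Binary.Infix.Heterogeneous.Properties using (infix?)
open import Data.List.Relation.Binary.Prefix.Heterogeneous using (Prefix)
open import Data.List.Relation.Binary.Prefix.Heterogeneous.Properties using (prefix?)
open import Data.Nat using (ℕ; zero; suc; _+_; _*_; _^_; _⊔_; _≤_; _<_; z≤n; s≤s)
open import Data.Nat.Properties
  using (anyUpTo?; m≤m⊔n; ∸-monoʳ-≤; ≤-refl; ≤-trans; ≤-reflexive)
open import Data.Product using (∃; ∃-syntax; _×_)
open import Relation.Binary using (DecidableEquality)
open import Relation.Binary.PropositionalEquality
  using (_≡_; refl; cong; trans)
open import Relation.Nullary using (does)
open import Relation.Unary using (Decidable)

private
  variable
    A : Set

-- The largest k ≤ m with P (take k s), or 0 if there is none.
longestUpTo : {P : List A → Set} → Decidable P → List A → ℕ → ℕ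
longestUpTo P? s zero    = 0
longestUpTo P? s (suc m) =
  if does (P? (take (suc m) s)) then suc m else longestUpTo P? s m

longestPrefix : {P : List A → Set} → Decidable P → List A → ℕ
longestPrefix P? s = longestUpTo P? s (length s)

-- Greedy factorization, where P i w says that w may be a copying phrase when
-- i symbols have already been parsed.
module Greedy {A : Set} {P : ℕ → List A → Set} (P? : ∀ i → Decidable (P i)) where

  -- A literal phrase has length 1, as does the shortest copying phrase.
  phraseLength : ℕ → List A → ℕ
  phraseLength i s = 1 ⊔ longestPrefix (P? i) s

  -- The first argument bounds the recursion; every phrase is non-empty, so
  -- the length of the string suffices (see concat-parse).
  parseFrom : ℕ → ℕ → List A → List (List A)
  parseFrom zero    i s         = []
  parseFrom (suc f) i []        = []
  parseFrom (suc f) i s@(_ ∷ _) = take k s ∷ parseFrom f (i + k) (drop k s)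
    where
    k : ℕ
    k = phraseLength i s

  parse : List A → List (List A)
  parse s = parseFrom (length s) 0 s

  concat-parseFrom : ∀ f i s → length s ≤ f → concat (parseFrom f i s) ≡ s
  concat-parseFrom zero    i []        _         = refl
  concat-parseFrom (suc f) i []        _         = refl
  concat-parseFrom (suc f) i s@(_ ∷ t) (s≤s t≤f) =
    trans (cong (take k s ++_) (concat-parseFrom f (i + k) (drop k s) rest≤f))
          (take++drop≡id k s)
    where
    k : ℕ
    k = phraseLength i s

    rest≤f : length (drop k s) ≤ f
    rest≤f = ≤-trans (≤-reflexive (length-drop k s))
      (≤-trans (∸-monoʳ-≤ (length s) (m≤m⊔n 1 (longestPrefix (P? i) s))) t≤f)

  concat-parse : ∀ s → concat (parse s) ≡ s
  concat-parse s = concat-parseFrom (length s) 0 s ≤-refl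

module Parsing {A : Set} (_≟_ : DecidableEquality A) where

  -- Positions are 0-based: the unparsed suffix of T starts at position i when
  -- i symbols have been parsed.
  OccursBefore : List A → ℕ → List A → Set
  OccursBefore T i w = ∃[ p ] (p < i × Prefix _≡_ w (drop p T))

  occursBefore? : ∀ T i → Decidable (OccursBefore T i)
  occursBefore? T i w = anyUpTo? (λ p → prefix? _≟_ w (drop p T)) i

  LZ : List A → List (List A)
  LZ T = Greedy.parse (occursBefore? T) T

  SubstringOf : List A → List A → Set
  SubstringOf R w = Infix _≡_ w R

  substringOf? : ∀ R → Decidable (SubstringOf R)
  substringOf? R w = infix? _≟_ w R

  RLZ : List A → List A → List (List A)
  RLZ T R = Greedy.parse {P = λ _ → SubstringOf R} (λ _ → substringOf? R) T

module _ {A : Set} (_≟_ : DecidableEquality A) where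
  open Parsing

  -- The metasymbol of a phrase is the phrase itself, as a string.
  metaString : ℕ → List A → List (List A)
  metaString ℓ T =
    LZ _≟_ (take ℓ T) ++ RLZ _≟_ (drop ℓ T) (take ℓ T)

  ReLZ : ℕ → List A → List (List A)
  ReLZ ℓ T = map concat (LZ (≡-dec _≟_) (metaString ℓ T))

String : Set
String = List (Fin 3)

z : String → ℕ
z T = length (Parsing.LZ Fin._≟_ T)

ẑ : ℕ → String → ℕ
ẑ ℓ T = length (ReLZ Fin._≟_ ℓ T)

-- a · log₂ n ≤ b, over the reals, for n ≥ 1.
_·log₂_≤_ : ℕ → ℕ → ℕ → Set
a ·log₂ n ≤ b = n ^ a ≤ 2 ^ b

ForLongStrings : (ℕ → String) → (ℕ → Set) → Set
ForLongStrings T Q = ∃[ N ] (∀ i → N ≤ length (T i) → Q i)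

-- f i = o(|T i|), with ε ranging over 1 / k.
IsLittleOLength : (ℕ → String) → (ℕ → ℕ) → Set
IsLittleOLength T f =
  ∀ k → ForLongStrings T (λ i → k * f i ≤ length (T i))

-- f i = Ω(g i · log₂ |T i|), with the constant C of the form 1 / c.
IsBigOmegaTimesLog : (ℕ → String) → (f g : ℕ → ℕ) → Set
IsBigOmegaTimesLog T f g =
  ∃[ c ] (0 < c × ForLongStrings T (λ i → g i ·log₂ length (T i) ≤ (c * f i)))

{-# OPTIONS --safe #-}

-- For m = 2n and K = n + 1 let wⱼ = 0ʲ 1 0ᵐ⁻ʲ, let the reference be
-- R = w₀ 2 w₁ 2 ⋯ wₘ 2, and let T = R S₀ S₁ ⋯ Sₙ, where the line Sⱼ is the
-- concatenation of wⱼ wⱼ, wⱼ wⱼ₊₁, …, wⱼ wⱼ₊ₙ.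
--
-- Since wⱼ₊₁ 0 = 0 wⱼ, also Sⱼ₊₁ 0 = 0 Sⱼ, so each line is the symbol 0
-- followed by a copy of a prefix of the previous line, and z = O(K).
-- A substring of R without the symbol 2 has length at most m + 1, so RLZ cuts
-- the lines exactly into the words wⱼ. The metastring therefore contains the
-- K² distinct bigrams wⱼ wₖ with j ≤ k ≤ j + n, j ≤ n. The first occurrence of a bigram
-- straddles an LZ phrase boundary, so ẑ ≥ K². As |R| = Θ(K²) and |T| = Θ(K³), the
-- gap is even polynomial in |T|.
module Submission where

open import Defs
open import Data.Fin.Patterns using (0F; 1F; 2F)
import Data.Fin.Properties as Fin
open import Data.List using (List; []; _∷_; [_]; _++_; _∷ʳ_; applyUpTo;
  cartesianProductWith; concat; drop; length; map; replicate; take; upTo)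
open import Data.List.Properties
  using (++-assoc; ++-identityʳ; ≡-dec; concat-concat; drop-all; drop-drop;
         length-++; length-++-≤ˡ; length-applyUpTo; length-drop;
         length-map; length-replicate; length-take; length-upTo; map-applyUpTo;
         take++drop≡id; ∷-injectiveˡ; ∷-injectiveʳ; ∷ʳ-++)
open import Data.List.Membership.Propositional using (_∈_)
open import Data.List.Membership.Propositional.Properties
  using (∈-++⁺ˡ; ∈-++⁺ʳ; ∈-++⁻; ∈-∃++; ∈-applyUpTo⁺; ∈-cartesianProductWith⁻; ∈-map⁺; ∈-upTo⁻)
open import Data.List.Relation.Binary.Infix.Heterogeneous using (Infix; MkView; toView; here; there; _ⁱ++_; _++ⁱ_)
import Data.List.Relation.Binary.Infix.Heterogeneous as Infix
import Data.List.Relation.Binary.Infix.Heterogeneous.Properties as Infix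
open import Data.List.Relation.Binary.Pointwise using (Pointwise-≡⇒≡)
open import Data.List.Relation.Binary.Prefix.Heterogeneous using (Prefix; []; _∷_; _++ᵖ_)
open import Data.List.Relation.Unary.All using (All; []; _∷_)
import Data.List.Relation.Unary.All as All
import Data.List.Relation.Unary.All.Properties as All
open import Data.List.Relation.Unary.AllPairs using ([]; _∷_)
open import Data.List.Relation.Unary.Any using (here; there)
open import Data.List.Relation.Unary.Unique.Propositional using (Unique)
open import Data.List.Relation.Unary.Unique.Propositional.Properties using (cartesianProductWith⁺; upTo⁺)
open import Data.Nat
open import Data.Nat.Induction using (<-rec)
open import Data.Nat.Properties
open import Data.Nat.Tactic.RingSolver using (solve-∀)
open import Data.Product using (Σ-syntax; ∃-syntax; _×_; _,_)
open import Data.Sum using (_⊎_; inj₁; inj₂)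
open import Function using (_∘_)
open import Function.Definitions using (Injective)
open import Relation.Binary using (DecidableEquality; tri<; tri≈; tri>)
open import Relation.Binary.PropositionalEquality
  using (_≡_; _≢_; refl; sym; trans; cong; cong₂; subst; subst₂; module ≡-Reasoning)
open import Relation.Nullary using (yes; no; contradiction)
open import Relation.Unary using (Decidable)

private
  variable
    A : Set

-- Splitting lists, prefixes, infixes and the pigeonhole principle.

drop-length-++ : ∀ (xs : List A) t {ys} → drop (length xs + t) (xs ++ ys) ≡ drop t ys
drop-length-++ []       t = refl
drop-length-++ (x ∷ xs) t = drop-length-++ xs t

take-length-++ : ∀ (xs : List A) {ys} → take (length xs) (xs ++ ys) ≡ xs
take-length-++ []       = refl
take-length-++ (x ∷ xs) = cong (x ∷_) (take-length-++ xs)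

drop-++-≤ : ∀ t (xs : List A) {ys} → t ≤ length xs → drop t (xs ++ ys) ≡ drop t xs ++ ys
drop-++-≤ zero    xs       _         = refl
drop-++-≤ (suc t) (x ∷ xs) (s≤s t≤)  = drop-++-≤ t xs t≤

take-++-≤ : ∀ n (xs : List A) {ys} → n ≤ length xs → take n (xs ++ ys) ≡ take n xs
take-++-≤ zero    xs       _        = refl
take-++-≤ (suc n) (x ∷ xs) (s≤s n≤) = cong (x ∷_) (take-++-≤ n xs n≤)

take-drop-++ : ∀ t n (xs : List A) {ys} → t + n ≤ length xs →
               take n (drop t (xs ++ ys)) ≡ take n (drop t xs)
take-drop-++ zero    n xs       n≤        = take-++-≤ n xs n≤
take-drop-++ (suc t) n (x ∷ xs) (s≤s t+n≤) = take-drop-++ t n xs t+n≤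

prefix-refl : ∀ (xs : List A) → Prefix _≡_ xs xs
prefix-refl []       = []
prefix-refl (x ∷ xs) = refl ∷ prefix-refl xs

prefix-split : ∀ {xs ys : List A} → Prefix _≡_ xs ys → ∃[ zs ] ys ≡ xs ++ zs
prefix-split []           = _ , refl
prefix-split (refl ∷ xs≤) with zs , refl ← prefix-split xs≤ = zs , refl

infix-refl : ∀ (xs : List A) → Infix _≡_ xs xs
infix-refl xs = here (prefix-refl xs)

infix-split : ∀ {v s : List A} → Infix _≡_ v s → ∃[ x ] ∃[ y ] s ≡ x ++ v ++ y
infix-split v⊑s with MkView x v≋ y ← toView v⊑s with refl ← Pointwise-≡⇒≡ v≋ = x , y , refl

infix-concat : ∀ {v : List A} {vs} → v ∈ vs → Infix _≡_ v (concat vs)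
infix-concat {vs = v ∷ vs} (here refl) = infix-refl v ⁱ++ concat vs
infix-concat {vs = v ∷ vs} (there v∈)  = v ++ⁱ infix-concat v∈

-- Remove one occurrence of the head of `xs` from `ys`: uniqueness keeps the head out of the tail,
-- so what remains of `ys` still contains the tail.
unique⇒length≤ : ∀ {xs ys : List A} → Unique xs → (∀ {x} → x ∈ xs → x ∈ ys) → length xs ≤ length ys
unique⇒length≤ []          _  = z≤n
unique⇒length≤ {xs = x ∷ xs} (x∉xs ∷ xs!) xs⊆ys with as , bs , refl ← ∈-∃++ (xs⊆ys (here refl)) = begin
  suc (length xs)             ≤⟨ s≤s (unique⇒length≤ xs! xs⊆as++bs) ⟩
  suc (length (as ++ bs))     ≡⟨ cong suc (length-++ as) ⟩
  suc (length as + length bs) ≡⟨ sym (+-suc (length as) (length bs)) ⟩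
  length as + suc (length bs) ≡⟨ sym (length-++ as) ⟩
  length (as ++ x ∷ bs)       ∎
  where
  open ≤-Reasoning
  xs⊆as++bs : ∀ {y} → y ∈ xs → y ∈ as ++ bs
  xs⊆as++bs y∈xs with ∈-++⁻ as (xs⊆ys (there y∈xs))
  ... | inj₁ y∈as         = ∈-++⁺ˡ y∈as
  ... | inj₂ (there y∈bs) = ∈-++⁺ʳ as y∈bs
  ... | inj₂ (here refl)  = contradiction refl (All.lookup x∉xs y∈xs)

-- Maximality and soundness of greedy phrases.

module _ {P : List A → Set} (P? : Decidable P) (s : List A) where

  ≤longestUpTo : ∀ m {k} → k ≤ m → P (take k s) → k ≤ longestUpTo P? s m
  ≤longestUpTo zero    k≤0 _ = k≤0
  ≤longestUpTo (suc m) k≤m Pk with P? (take (suc m) s)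
  ... | yes _  = k≤m
  ... | no ¬Pm with m≤n⇒m<n∨m≡n k≤m
  ...   | inj₁ (s≤s k≤m′) = ≤longestUpTo m k≤m′ Pk
  ...   | inj₂ refl       = contradiction Pk ¬Pm

  longestUpTo≤ : ∀ m → longestUpTo P? s m ≤ m
  longestUpTo≤ zero    = z≤n
  longestUpTo≤ (suc m) with P? (take (suc m) s)
  ... | yes _ = ≤-refl
  ... | no  _ = m≤n⇒m≤1+n (longestUpTo≤ m)

  longestUpTo-sound : ∀ m → 0 < longestUpTo P? s m → P (take (longestUpTo P? s m) s)
  longestUpTo-sound (suc m) 0<k with P? (take (suc m) s)
  ... | yes Pm = Pm
  ... | no  _  = longestUpTo-sound m 0<k

module _ {P : ℕ → List A → Set} (P? : ∀ i → Decidable (P i)) where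
  open Greedy P?

  ≤phraseLength : ∀ i s {k} → k ≤ length s → P i (take k s) → k ≤ phraseLength i s
  ≤phraseLength i s k≤ Pk = ≤-trans (≤longestUpTo (P? i) s (length s) k≤ Pk) (m≤n⊔m 1 _)

  -- A phrase of length 1 may be a literal; beyond that the maximum with 1 is attained by
  -- `longestPrefix`, so the phrase is a copy.
  phraseLength-copying : ∀ i s → 1 < phraseLength i s →
    phraseLength i s ≤ length s × P i (take (phraseLength i s) s)
  phraseLength-copying i s 1<k
    with longestPrefix (P? i) s | longestUpTo≤ (P? i) s (length s)
       | longestUpTo-sound (P? i) s (length s)
  ... | zero  | _  | _  = contradiction 1<k (<-irrefl refl)
  ... | suc n | n≤ | Pn = n≤ , Pn z<s

  -- The condition `0 < a` covers the literal phrases, which need not satisfy `P`.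
  phraseLength≤ : ∀ i s {a} → 0 < a → (∀ k → P i (take k s) → k ≤ length s → k ≤ a) → phraseLength i s ≤ a
  phraseLength≤ i s 0<a bound with 2 ≤? phraseLength i s
  ... | yes 1<k = let k≤ , Pk = phraseLength-copying i s 1<k in bound _ Pk k≤
  ... | no  1≮k = ≤-trans (≤-pred (≰⇒> 1≮k)) 0<a

-- Greedy LZ parsing uses at most as many phrases as any encoding.

-- Encoding pre w k: after pre, the string w can be written with k phrases, each
-- a single symbol or a non-overlapping copy of earlier text.
data Encoding {A : Set} : List A → List A → ℕ → Set where
  []      : ∀ {pre} → Encoding pre [] 0
  literal : ∀ {pre c w k} → Encoding (pre ++ [ c ]) w k → Encoding pre (c ∷ w) (suc k)
  copy    : ∀ {pre v w k} → Infix _≡_ v pre → Encoding (pre ++ v) w k →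
            Encoding pre (v ++ w) (suc k)

module _ {A : Set} (_≟ᴬ_ : DecidableEquality A) where
  open Parsing _≟ᴬ_

  module _ (T : List A) where
    open Greedy (occursBefore? T)

    -- One greedy phrase is charged to one phrase of the encoding: it reaches `b`, and from there on
    -- `k` phrases suffice. Fuel is arbitrary because running out of it only shortens the parse.
    length-parseFrom-step : ∀ {b k} → (∀ f i → b ≤ i → length (parseFrom f i (drop i T)) ≤ k) →
      ∀ f i s → drop i T ≡ s → b ≤ i + phraseLength i s → length (parseFrom f i s) ≤ suc k
    length-parseFrom-step rest zero    i s         _   _  = z≤n
    length-parseFrom-step rest (suc f) i []        _   _  = z≤n
    length-parseFrom-step {k = k} rest (suc f) i s@(_ ∷ _) i-s b≤ =
      s≤s (subst (λ r → length (parseFrom f (i + l) r) ≤ k)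
        (trans (sym (drop-drop i l T)) (cong (drop l) i-s)) (rest f (i + l) b≤))
      where
      l : ℕ
      l = phraseLength i s

    -- If `i` lies at offset `t` inside the copied `v`, the remainder `drop t v` also occurs at
    -- offset `t` of the source, so the greedy phrase is at least that long. Past the end of `v`
    -- nothing is left to reach.
    copy-reach : ∀ pre v {w} → Infix _≡_ v pre → pre ++ v ++ w ≡ T → ∀ i → length pre ≤ i →
      length (pre ++ v) ≤ i + phraseLength i (drop i T)
    copy-reach pre v {w} v⊑pre refl i pre≤i with length (pre ++ v) ≤? i | infix-split v⊑pre
    ... | yes ≤i | _ = ≤-trans ≤i (m≤m+n i _)
    ... | no ≰i | x , y , refl = begin
        length (pre ++ v)              ≡⟨ length-++ pre ⟩
        length pre + length v          ≡⟨ cong (length pre +_) (sym (m+[n∸m]≡n (<⇒≤ t<v))) ⟩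
        length pre + (t + (length v ∸ t)) ≡⟨ sym (+-assoc (length pre) t _) ⟩
        length pre + t + (length v ∸ t) ≡⟨ cong₂ _+_ pre+t≡i (sym (length-drop t v)) ⟩
        i + length (drop t v)          ≤⟨ +-monoʳ-≤ i (≤phraseLength (occursBefore? T) i (drop i T) fits
                                             (length x + t , p<i , occurs)) ⟩
        i + phraseLength i (drop i T)  ∎
      where
      open ≤-Reasoning
      t : ℕ
      t = i ∸ length pre
      pre+t≡i : length pre + t ≡ i
      pre+t≡i = m+[n∸m]≡n pre≤i
      t<v : t < length v
      t<v = +-cancelˡ-< (length pre) t (length v) (begin-strict
        length pre + t        ≡⟨ pre+t≡i ⟩
        i                     <⟨ ≰⇒> ≰i ⟩
        length (pre ++ v)     ≡⟨ length-++ pre ⟩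
        length pre + length v ∎)
      suffix : drop i T ≡ drop t v ++ w
      suffix = trans (cong (λ j → drop j T) (sym pre+t≡i))
        (trans (drop-length-++ pre t) (drop-++-≤ t v (<⇒≤ t<v)))
      fits : length (drop t v) ≤ length (drop i T)
      fits = subst (λ s → length (drop t v) ≤ length s) (sym suffix)
        (≤-trans (m≤m+n _ _) (≤-reflexive (sym (length-++ (drop t v)))))
      source : drop (length x + t) T ≡ drop t v ++ y ++ v ++ w
      source = trans (cong (drop (length x + t))
          (trans (++-assoc x (v ++ y) (v ++ w)) (cong (x ++_) (++-assoc v y (v ++ w)))))
        (trans (drop-length-++ x t) (drop-++-≤ t v (<⇒≤ t<v)))
      occurs : Prefix _≡_ (take (length (drop t v)) (drop i T)) (drop (length x + t) T)
      occurs = subst₂ (Prefix _≡_)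
        (sym (trans (cong (take (length (drop t v))) suffix) (take-length-++ (drop t v))))
        (sym source) (prefix-refl (drop t v) ++ᵖ (y ++ v ++ w))
      -- The source lies inside `pre` and `v` is non-empty, so the source starts strictly before
      -- `pre` ends; adding `t` to both positions keeps the order.
      p<i : length x + t < i
      p<i = begin-strict
        length x + t            <⟨ +-monoˡ-< t (m<m+n (length x) (≤-<-trans z≤n t<v)) ⟩
        length x + length v + t ≤⟨ +-monoˡ-≤ t (+-monoʳ-≤ (length x) (m≤m+n (length v) (length y))) ⟩
        length x + (length v + length y) + t ≡⟨ cong (λ l → length x + l + t) (sym (length-++ v)) ⟩
        length x + length (v ++ y) + t ≡⟨ cong (_+ t) (sym (length-++ x)) ⟩
        length pre + t          ≡⟨ pre+t≡i ⟩
        i                       ∎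

    -- The invariant: greedy has reached i, which may lie strictly inside a phrase of the encoding.
    parseFrom≤ : ∀ {pre w k} → Encoding pre w k → pre ++ w ≡ T → ∀ f i → length pre ≤ i →
      length (parseFrom f i (drop i T)) ≤ k
    parseFrom≤ {pre} [] refl zero    i pre≤i = z≤n
    parseFrom≤ {pre} [] refl (suc f) i pre≤i
      rewrite drop-all i (pre ++ []) (≤-trans (≤-reflexive (trans (length-++ pre) (+-identityʳ _))) pre≤i) = z≤n
    parseFrom≤ {pre} (literal {c = c} {w} enc) eq f i pre≤i =
      length-parseFrom-step (parseFrom≤ enc (trans (++-assoc pre [ c ] w) eq)) f i (drop i T) refl (begin
        length (pre ++ [ c ])          ≡⟨ length-++ pre ⟩
        length pre + 1                 ≤⟨ +-mono-≤ pre≤i (m≤m⊔n 1 (longestPrefix (occursBefore? T i) (drop i T))) ⟩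
        i + phraseLength i (drop i T)  ∎)
      where open ≤-Reasoning
    parseFrom≤ {pre} (copy {v = v} {w} v⊑ enc) eq f i pre≤i =
      length-parseFrom-step (parseFrom≤ enc (trans (++-assoc pre v w) eq)) f i (drop i T) refl
        (copy-reach pre v v⊑ eq i pre≤i)

  LZ≤encoding : ∀ {T k} → Encoding [] T k → length (LZ T) ≤ k
  LZ≤encoding {T} enc = parseFrom≤ T enc refl (length T) 0 z≤n

  -- Distinct bigrams as a lower bound for LZ.

  bigram : List A → ℕ → List A
  bigram T u = take 2 (drop u T)

  infix⇒bigram : ∀ {x y T} → Infix _≡_ (x ∷ y ∷ []) T → ∃[ u ] (u < length T × bigram T u ≡ x ∷ y ∷ [])
  infix⇒bigram (here (refl ∷ refl ∷ [])) = 0 , z<s , refl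
  infix⇒bigram (there xy⊑) with u , u< , eq ← infix⇒bigram xy⊑ = suc u , s<s u< , eq

  module _ (T : List A) where
    open Greedy (occursBefore? T)

    -- The condition `t + 2 ≤ k` puts both symbols inside the phrase, which reads the same at `p`
    -- and at `i`.
    copied-bigram : ∀ i {s} k p t → drop i T ≡ s → k ≤ length s → t + 2 ≤ k →
      Prefix _≡_ (take k s) (drop p T) → bigram T (p + t) ≡ bigram T (i + t)
    copied-bigram i {s} k p t i-s k≤ t+2≤k v≤ with zs , eq ← prefix-split v≤ = begin
      take 2 (drop (p + t) T)     ≡⟨ cong (take 2) (sym (drop-drop p t T)) ⟩
      take 2 (drop t (drop p T))  ≡⟨ cong (take 2 ∘ drop t) eq ⟩
      take 2 (drop t (v ++ zs))   ≡⟨ take-drop-++ t 2 v t+2≤v ⟩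
      take 2 (drop t v)           ≡⟨ sym (take-drop-++ t 2 v t+2≤v) ⟩
      take 2 (drop t (v ++ drop k s)) ≡⟨ cong (take 2 ∘ drop t) (trans (take++drop≡id k s) (sym i-s)) ⟩
      take 2 (drop t (drop i T))  ≡⟨ cong (take 2) (drop-drop i t T) ⟩
      take 2 (drop (i + t) T)     ∎
      where
      open ≡-Reasoning
      v : List A
      v = take k s
      t+2≤v : t + 2 ≤ length v
      t+2≤v = ≤-trans t+2≤k (≤-reflexive (sym (trans (length-take k s) (m≤n⇒m⊓n≡m k≤))))

    -- A bigram inside a phrase is copied from an earlier position; the others are
    -- the at most one per phrase that start at its last symbol.
    boundaryBigrams : ∀ f i s → length s ≤ f → drop i T ≡ s →
      Σ[ bs ∈ List (List A) ] (length bs ≤ length (parseFrom f i s) ×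
        (∀ u → i ≤ u → u < length T →
          bigram T u ∈ bs ⊎ ∃[ u′ ] (u′ < u × bigram T u′ ≡ bigram T u)))
    boundaryBigrams f i [] _ eq = [] , z≤n , λ u i≤u u<T → contradiction (begin-strict
        0                    <⟨ m<n⇒0<n∸m (≤-<-trans i≤u u<T) ⟩
        length T ∸ i         ≡⟨ sym (length-drop i T) ⟩
        length (drop i T)    ≡⟨ cong length eq ⟩
        0                    ∎) (<-irrefl refl)
      where open ≤-Reasoning
    boundaryBigrams (suc f) i s@(_ ∷ r) (s≤s r≤f) i-s
      with bs , bs≤ , covers ← boundaryBigrams f (i + phraseLength i s) (drop (phraseLength i s) s)
             (≤-trans (≤-reflexive (length-drop (phraseLength i s) s))
               (≤-trans (∸-monoʳ-≤ (length s) (m≤m⊔n 1 (longestPrefix (occursBefore? T i) s))) r≤f))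
             (trans (sym (drop-drop i (phraseLength i s) T)) (cong (drop (phraseLength i s)) i-s))
      = bigram T (pred (i + k)) ∷ bs , s≤s bs≤ , covers′
      where
      open ≤-Reasoning
      k : ℕ
      k = phraseLength i s
      covers′ : ∀ u → i ≤ u → u < length T →
        bigram T u ∈ bigram T (pred (i + k)) ∷ bs ⊎ ∃[ u′ ] (u′ < u × bigram T u′ ≡ bigram T u)
      -- The last position of the phrase is `i + k` minus 1. At it the bigram is the recorded one,
      -- after it `u` belongs to later phrases, before it both symbols lie in the phrase.
      covers′ u i≤u u<T with <-cmp (suc u) (i + k)
      ... | tri≈ _ u+1≡ _ = inj₁ (here (cong (bigram T ∘ pred) u+1≡))
      ... | tri> _ _ i+k<u+1 with covers u (≤-pred i+k<u+1) u<T
      ...   | inj₁ ∈bs    = inj₁ (there ∈bs)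
      ...   | inj₂ earlier = inj₂ earlier
      covers′ u i≤u u<T | tri< u+1< _ _ with t , refl ← m≤n⇒∃[o]m+o≡n i≤u
        = inj₂ (inside (+-cancelˡ-≤ i (t + 2) k
            (≤-trans (≤-reflexive (trans (sym (+-assoc i t 2)) (+-comm (i + t) 2))) u+1<)))
        where
        inside : t + 2 ≤ k → ∃[ u′ ] (u′ < i + t × bigram T u′ ≡ bigram T (i + t))
        inside t+2≤k =
          let k≤ , p , p<i , v≤ = phraseLength-copying (occursBefore? T) i s (≤-trans (m≤n+m 2 t) t+2≤k)
          in p + t , +-monoˡ-< t p<i , copied-bigram i k p t i-s k≤ t+2≤k v≤

    -- Moving to an earlier occurrence must stop, so strong induction on the position traces every
    -- bigram back to a boundary bigram. There is at most one of these per phrase, and the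
    -- pigeonhole principle finishes.
    bigrams≤LZ : ∀ {gs} → Unique gs → (∀ {g} → g ∈ gs → ∃[ u ] (u < length T × bigram T u ≡ g)) →
      length gs ≤ length (LZ T)
    bigrams≤LZ gs! occur with bs , bs≤ , covers ← boundaryBigrams (length T) 0 T ≤-refl refl =
      ≤-trans (unique⇒length≤ gs! gs⊆bs) bs≤
      where
      covered : ∀ u → u < length T → bigram T u ∈ bs
      covered = <-rec _ λ u rec u<T → case-covers u (λ u′<u → rec u′<u (<-trans u′<u u<T)) (covers u z≤n u<T)
        where
        case-covers : ∀ u → (∀ {u′} → u′ < u → bigram T u′ ∈ bs) →
          bigram T u ∈ bs ⊎ ∃[ u′ ] (u′ < u × bigram T u′ ≡ bigram T u) → bigram T u ∈ bs
        case-covers u rec (inj₁ ∈bs)             = ∈bs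
        case-covers u rec (inj₂ (_ , u′<u , eq)) = subst (_∈ bs) eq (rec u′<u)
      gs⊆bs : ∀ {g} → g ∈ _ → g ∈ bs
      gs⊆bs g∈ with u , u<T , refl ← occur g∈ = covered u u<T

-- Building encodings.

encode-++ : ∀ {pre v w : List A} {k l} → Encoding pre v k → Encoding (pre ++ v) w l →
            Encoding pre (v ++ w) (k + l)
encode-++ {pre = pre} [] enc = subst (λ p → Encoding p _ _) (++-identityʳ pre) enc
encode-++ {pre = pre} (literal {c = c} {w = v} enc₁) enc₂ =
  literal (encode-++ enc₁ (subst (λ p → Encoding p _ _) (sym (++-assoc pre [ c ] v)) enc₂))
encode-++ {pre = pre} (copy {v = u} {w = v} u⊑pre enc₁) enc₂ =
  subst (λ w → Encoding pre w _) (sym (++-assoc u v _))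
    (copy u⊑pre (encode-++ enc₁ (subst (λ p → Encoding p _ _) (sym (++-assoc pre u v)) enc₂)))

encode-literals : ∀ {pre} (w : List A) → Encoding pre w (length w)
encode-literals []      = []
encode-literals (c ∷ w) = literal (encode-literals w)

encode-copy : ∀ {pre v : List A} → Infix _≡_ v pre → Encoding pre v 1
encode-copy {pre = pre} {v} v⊑pre = subst (λ w → Encoding pre w 1) (++-identityʳ v) (copy v⊑pre [])

encode-copies : ∀ {pre : List A} vs → All (λ v → Infix _≡_ v pre) vs → Encoding pre (concat vs) (length vs)
encode-copies []       []            = []
encode-copies (v ∷ vs) (v⊑ ∷ vs⊑) = copy v⊑ (encode-copies vs (All.map (_ⁱ++ v) vs⊑))

-- One literal `c`, then one copy of `u` as a prefix of the earlier `v`.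
encode-shift : ∀ {pre v u : List A} {c} → u ∷ʳ c ≡ v → Infix _≡_ v pre → Encoding pre (c ∷ u) 2
encode-shift {u = u} {c} refl v⊑pre = literal (encode-copy
  (Infix.Infix-Prefix-trans trans
    (Infix.Prefix-Infix-trans trans (prefix-refl u ++ᵖ [ c ]) v⊑pre) (prefix-refl _ ++ᵖ [ c ])))

-- Each step is required for every `pre` because the text before `f j` grows along the chain; the
-- source can be `f j` itself.
encode-chain : ∀ (f : ℕ → List A) n {pre k l} → Encoding pre (f 0) k →
  (∀ j → j < n → ∀ pre → Encoding (pre ++ f j) (f (suc j)) l) →
  Encoding pre (concat (applyUpTo f (suc n))) (k + n * l)
encode-chain f zero    enc _    = encode-++ enc []
encode-chain f (suc n) enc step =
  encode-++ enc (encode-chain (f ∘ suc) n (step 0 z<s _) (λ j j<n → step (suc j) (s<s j<n)))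

-- Separators confine factors to blocks, and RLZ cuts block by block.

sentinel-prefix : ∀ {c} {w : List A} v {r} → All (_≢ c) w → Prefix _≡_ w (v ++ c ∷ r) → length w ≤ length v
sentinel-prefix v       []           _            = z≤n
sentinel-prefix []      (x≢c ∷ _)    (refl ∷ _)   = contradiction refl x≢c
sentinel-prefix (_ ∷ v) (_ ∷ w≢c)    (_ ∷ w≤)     = s≤s (sentinel-prefix v w≢c w≤)

-- An occurrence starting inside `v` cannot run across the separator `c`; a non-empty one cannot
-- start at it; all others lie in `r`.
sentinel-infix : ∀ {c} {w : List A} v {r} → All (_≢ c) w → Infix _≡_ w (v ++ c ∷ r) →
  length w ≤ length v ⊎ Infix _≡_ w r
sentinel-infix []      w≢c (here w≤)  = inj₁ (sentinel-prefix [] w≢c w≤)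
sentinel-infix []      w≢c (there w⊑) = inj₂ w⊑
sentinel-infix (x ∷ v) w≢c (here w≤)  = inj₁ (sentinel-prefix (x ∷ v) w≢c w≤)
sentinel-infix (_ ∷ v) w≢c (there w⊑) with sentinel-infix v w≢c w⊑
... | inj₁ w≤ = inj₁ (m≤n⇒m≤1+n w≤)
... | inj₂ w⊑r = inj₂ w⊑r

sentinel-factor : ∀ {c a} {w : List A} {vs} → All (λ v → length v ≤ a) vs → All (_≢ c) w →
  Infix _≡_ w (concat (map (_∷ʳ c) vs)) → length w ≤ a
sentinel-factor []         _ w⊑ = ≤-trans (Infix.length-mono w⊑) z≤n
sentinel-factor {c = c} {vs = v ∷ vs} (v≤a ∷ vs≤a) w≢c w⊑
  with sentinel-infix v w≢c (subst (Infix _≡_ _) (∷ʳ-++ v c _) w⊑)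
... | inj₁ w≤v = ≤-trans w≤v v≤a
... | inj₂ w⊑′ = sentinel-factor vs≤a w≢c w⊑′

module _ {A : Set} (_≟ᴬ_ : DecidableEquality A) where
  open Parsing _≟ᴬ_

  module _ {R : List A} {c a} (0<a : 0 < a) (bound : ∀ {w} → All (_≢ c) w → Infix _≡_ w R → length w ≤ a) where
    open Greedy {P = λ _ → SubstringOf R} (λ _ → substringOf? R)

    -- The next block is itself a factor of `R`, so the phrase has length at least `a`. The unparsed
    -- text avoids `c`, so `bound` forbids anything longer, and the cut falls on the block boundary.
    parseFrom-blocks : ∀ f i vs → length (concat vs) ≤ f →
      All (λ v → length v ≡ a) vs → All (λ v → Infix _≡_ v R) vs → All (All (_≢ c)) vs →
      parseFrom f i (concat vs) ≡ vs
    parseFrom-blocks zero    i []       _ _ _ _ = refl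
    parseFrom-blocks (suc f) i []       _ _ _ _ = refl
    parseFrom-blocks f i ([] ∷ vs) _ (refl ∷ _) _ _ = contradiction 0<a (<-irrefl refl)
    parseFrom-blocks (suc f) i (v@(x ∷ v′) ∷ vs) (s≤s vs≤f) (v≡a ∷ vs≡a) (v⊑R ∷ vs⊑R) (v≢c ∷ vs≢c)
      = cong₂ _∷_
          (trans (cong (λ k → take k s) k≡v) (take-length-++ v))
          (trans (cong (parseFrom f _)
                   (trans (cong (λ k → drop k s) (trans k≡v (sym (+-identityʳ _)))) (drop-length-++ v 0)))
                 (parseFrom-blocks f _ vs
                   (≤-trans (≤-trans (m≤n+m _ (length v′)) (≤-reflexive (sym (length-++ v′)))) vs≤f)
                   vs≡a vs⊑R vs≢c))
      where
      s : List A
      s = v ++ concat vs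
      s≢c : All (_≢ c) s
      s≢c = All.++⁺ v≢c (All.concat⁺ vs≢c)
      v≤s : length v ≤ length s
      v≤s = ≤-trans (m≤m+n _ _) (≤-reflexive (sym (length-++ v)))
      k≡v : phraseLength i s ≡ length v
      k≡v = ≤-antisym
        (≤-trans (phraseLength≤ (λ _ → substringOf? R) i s 0<a
          (λ k k⊑R k≤ → ≤-trans (≤-reflexive (sym (trans (length-take k s) (m≤n⇒m⊓n≡m k≤))))
             (bound (All.take⁺ k s≢c) k⊑R))) (≤-reflexive (sym v≡a)))
        (≤phraseLength (λ _ → substringOf? R) i s v≤s
          (subst (λ w → Infix _≡_ w R) (sym (take-length-++ v)) v⊑R))

    RLZ-blocks : ∀ vs → All (λ v → length v ≡ a) vs → All (λ v → Infix _≡_ v R) vs → All (All (_≢ c)) vs →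
      RLZ (concat vs) R ≡ vs
    RLZ-blocks vs = parseFrom-blocks _ 0 vs ≤-refl

-- Runs of one symbol and lengths of composite lists.

replicate-∷ʳ : ∀ n (x : A) → replicate n x ∷ʳ x ≡ x ∷ replicate n x
replicate-∷ʳ zero    x = refl
replicate-∷ʳ (suc n) x = cong (x ∷_) (replicate-∷ʳ n x)

-- The first symbol different from `x` marks where the run ends.
run-injective : ∀ m n {x y z : A} {xs ys} → y ≢ x → z ≢ x →
  replicate m x ++ y ∷ xs ≡ replicate n x ++ z ∷ ys → m ≡ n
run-injective zero    zero    _   _   _    = refl
run-injective zero    (suc n) y≢x _   refl = contradiction refl y≢x
run-injective (suc m) zero    _   z≢x refl = contradiction refl z≢x
run-injective (suc m) (suc n) y≢x z≢x eq   = cong suc (run-injective m n y≢x z≢x (∷-injectiveʳ eq))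

length-concat : ∀ c (vs : List (List A)) → All (λ v → length v ≡ c) vs → length (concat vs) ≡ length vs * c
length-concat c []       []            = refl
length-concat c (v ∷ vs) (v≡c ∷ vs≡c) = trans (length-++ v) (cong₂ _+_ v≡c (length-concat c vs vs≡c))

length-cartesianProductWith : ∀ {B C : Set} (f : A → B → C) xs ys →
  length (cartesianProductWith f xs ys) ≡ length xs * length ys
length-cartesianProductWith f []       ys = refl
length-cartesianProductWith f (x ∷ xs) ys = trans (length-++ (map (f x) ys))
  (cong₂ _+_ (length-map (f x) ys) (length-cartesianProductWith f xs ys))

-- The words, the reference, the lines and the text.

word : ℕ → ℕ → String
word m j = replicate j 0F ++ 1F ∷ replicate (m ∸ j) 0F

-- Both sides have `j + 1` zeros before the `1F` and `m ∸ j` after it; `j < m` keeps the truncated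
-- subtraction exact.
word-shift : ∀ {m j} → j < m → word m (suc j) ∷ʳ 0F ≡ 0F ∷ word m j
word-shift {m} {j} j<m = cong (0F ∷_) (trans (++-assoc (replicate j 0F) _ _)
  (cong (λ w → replicate j 0F ++ 1F ∷ w)
    (trans (replicate-∷ʳ (m ∸ suc j) 0F) (cong (λ k → replicate k 0F) (sym (+-∸-assoc 1 j<m))))))

length-word : ∀ {m j} → j ≤ m → length (word m j) ≡ suc m
length-word {m} {j} j≤m = begin
  length (word m j)   ≡⟨ length-++ (replicate j 0F) ⟩
  length (replicate j 0F) + suc (length (replicate (m ∸ j) 0F))
                      ≡⟨ cong₂ (λ x y → x + suc y) (length-replicate j) (length-replicate (m ∸ j)) ⟩
  j + suc (m ∸ j)     ≡⟨ +-suc j (m ∸ j) ⟩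
  suc (j + (m ∸ j))   ≡⟨ cong suc (m+[n∸m]≡n j≤m) ⟩
  suc m               ∎
  where open ≡-Reasoning

word-injective : ∀ m {j k} → word m j ≡ word m k → j ≡ k
word-injective m {j} {k} = run-injective j k (λ ()) (λ ())

word≢2 : ∀ m j → All (_≢ 2F) (word m j)
word≢2 m j = All.++⁺ (All.replicate⁺ j (λ ())) ((λ ()) ∷ All.replicate⁺ (m ∸ j) (λ ()))

words : ℕ → List String
words m = applyUpTo (word m) (suc m)

reference : ℕ → String
reference m = concat (map (_∷ʳ 2F) (words m))

-- The sequence 0, 0, 0, 1, up to 0, n. Every line uses the same offsets, so shifting a line amounts
-- to shifting each of its words.
offsets : ℕ → List ℕ
offsets n = concat (applyUpTo (λ d → 0 ∷ d ∷ []) (suc n))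

lineWords : ℕ → ℕ → List String
lineWords n j = map (λ d → word (n + n) (j + d)) (offsets n)

line : ℕ → ℕ → String
line n j = concat (lineWords n j)

bodyWords : ℕ → List String
bodyWords n = concat (applyUpTo (lineWords n) (suc n))

body : ℕ → String
body n = concat (bodyWords n)

text : ℕ → String
text n = reference (n + n) ++ body n

-- RLZ sees the body as a sequence of words, the encoding as a sequence of lines; this reconciles
-- the two views.
body≡lines : ∀ n → concat (applyUpTo (line n) (suc n)) ≡ body n
body≡lines n = trans (cong concat (sym (map-applyUpTo (lineWords n) concat (suc n))))
  (concat-concat (applyUpTo (lineWords n) (suc n)))

offsets≤ : ∀ n → All (_≤ n) (offsets n)
offsets≤ n = All.concat⁺ (All.applyUpTo⁺₁ _ (suc n) (λ { (s≤s d≤n) → z≤n ∷ d≤n ∷ [] }))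

word⊑reference : ∀ {m j} → j ≤ m → Infix _≡_ (word m j) (reference m)
word⊑reference {m} {j} j≤m = Infix.Prefix-Infix-trans trans (prefix-refl _ ++ᵖ [ 2F ])
  (infix-concat (∈-map⁺ (_∷ʳ 2F) (∈-applyUpTo⁺ (word m) (s≤s j≤m))))

-- The line index and the offset are each at most `n`, which is why words with index up to `n + n`
-- suffice.
all-bodyWords : ∀ n {P : String → Set} → (∀ {j} → j ≤ n + n → P (word (n + n) j)) → All P (bodyWords n)
all-bodyWords n Pw = All.concat⁺ (All.applyUpTo⁺₁ (lineWords n) (suc n)
  (λ { (s≤s j≤n) → All.map⁺ (All.map (λ d≤n → Pw (+-mono-≤ j≤n d≤n)) (offsets≤ n)) }))

-- The trailing `c` travels leftwards through the concatenation, turning each `f d` it passes into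
-- `g d`.
concat-shift : ∀ {A D : Set} {c : A} {f g : D → List A} ds → All (λ d → f d ∷ʳ c ≡ c ∷ g d) ds →
  concat (map f ds) ∷ʳ c ≡ c ∷ concat (map g ds)
concat-shift []       []         = refl
concat-shift {c = c} {f} {g} (d ∷ ds) (eq ∷ eqs) = begin
  (f d ++ concat (map f ds)) ∷ʳ c ≡⟨ ++-assoc (f d) _ _ ⟩
  f d ++ concat (map f ds) ∷ʳ c   ≡⟨ cong (f d ++_) (concat-shift ds eqs) ⟩
  f d ++ c ∷ concat (map g ds)    ≡⟨ sym (∷ʳ-++ (f d) c _) ⟩
  f d ∷ʳ c ++ concat (map g ds)   ≡⟨ cong (_++ concat (map g ds)) eq ⟩
  c ∷ g d ++ concat (map g ds)    ∎
  where open ≡-Reasoning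

line-shift : ∀ n {j} → j < n → line n (suc j) ∷ʳ 0F ≡ 0F ∷ line n j
line-shift n {j} j<n = concat-shift
  {f = λ d → word (n + n) (suc j + d)} {g = λ d → word (n + n) (j + d)} (offsets n)
  (All.map (λ d≤n → word-shift (+-mono-≤ j<n d≤n)) (offsets≤ n))

-- Encoding sizes, exact lengths and the upper bound for `z`.

-- The first line costs one copy per word; each of the `n` later lines costs two phrases by the
-- shift.
encode-body : ∀ n {pre} → (∀ {j} → j ≤ n + n → Infix _≡_ (word (n + n) j) pre) →
  Encoding pre (body n) (length (offsets n) + n * 2)
encode-body n {pre} word⊑pre = subst (λ w → Encoding pre w (length (offsets n) + n * 2)) (body≡lines n)
  (encode-chain (line n) n
    (subst (Encoding pre (line n 0)) (length-map _ (offsets n))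
      (encode-copies (lineWords n 0) (All.map⁺ (All.map (λ d≤n → word⊑pre (≤-trans d≤n (m≤m+n n n))) (offsets≤ n)))))
    (λ j j<n pre → encode-shift (∷-injectiveʳ (line-shift n j<n)) (pre ++ⁱ infix-refl (line n j))))

-- The first block is spelled out in `m + 2` literals. Each of the `m` later blocks takes two
-- phrases for the shifted word and a literal `2F`.
encode-reference : ∀ m → Encoding [] (reference m) (2 + m + m * 3)
encode-reference m = subst₂ (Encoding [])
  (cong concat (sym (map-applyUpTo (word m) (_∷ʳ 2F) (suc m))))
  (cong (_+ m * 3) (trans (length-++ (word m 0)) (trans (cong (_+ 1) (length-word {m} z≤n)) (+-comm (suc m) 1))))
  (encode-chain (λ j → word m j ∷ʳ 2F) m (encode-literals (word m 0 ∷ʳ 2F))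
    (λ j j<m pre → encode-++
      (encode-shift (∷-injectiveʳ (word-shift j<m)) (pre ++ⁱ infix-refl (word m j) ⁱ++ [ 2F ]))
      (encode-literals [ 2F ])))

length-offsets : ∀ n → length (offsets n) ≡ suc n * 2
length-offsets n = trans
  (length-concat 2 (applyUpTo pair (suc n)) (All.applyUpTo⁺₂ pair (suc n) (λ _ → refl)))
  (cong (_* 2) (length-applyUpTo pair (suc n)))
  where
  pair : ℕ → List ℕ
  pair d = 0 ∷ d ∷ []

length-reference : ∀ m → length (reference m) ≡ suc m * suc (suc m)
length-reference m = trans
  (length-concat (suc (suc m)) (map (_∷ʳ 2F) (words m)) (All.map⁺ (All.applyUpTo⁺₁ (word m) (suc m)
    (λ {j} j<1+m → trans (length-++ (word m j)) (trans (cong (_+ 1) (length-word (≤-pred j<1+m))) (+-comm (suc m) 1))))))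
  (cong (_* suc (suc m)) (trans (length-map _ (words m)) (length-applyUpTo (word m) (suc m))))

length-body : ∀ n → length (body n) ≡ suc n * (suc n * 2) * suc (n + n)
length-body n = trans (length-concat (suc (n + n)) (bodyWords n) (all-bodyWords n length-word))
  (cong (_* suc (n + n)) (trans
    (length-concat (suc n * 2) (applyUpTo (lineWords n) (suc n))
      (All.applyUpTo⁺₂ (lineWords n) (suc n) (λ j → trans (length-map _ (offsets n)) (length-offsets n))))
    (cong (_* (suc n * 2)) (length-applyUpTo (lineWords n) (suc n)))))

z-text≤ : ∀ n → z (text n) ≤ 2 + (n + n) + (n + n) * 3 + (suc n * 2 + n * 2)
z-text≤ n = LZ≤encoding Fin._≟_ (encode-++ (encode-reference (n + n))
  (subst (λ l → Encoding (reference (n + n)) (body n) (l + n * 2)) (length-offsets n) (encode-body n word⊑reference)))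

-- The metastring and the lower bound for `ẑ`.

RLZ-body : ∀ n → Parsing.RLZ Fin._≟_ (body n) (reference (n + n)) ≡ bodyWords n
RLZ-body n = RLZ-blocks Fin._≟_ z<s
  (sentinel-factor (All.applyUpTo⁺₁ (word (n + n)) (suc (n + n)) (≤-reflexive ∘ length-word ∘ ≤-pred)))
  (bodyWords n) (all-bodyWords n length-word) (all-bodyWords n word⊑reference)
  (all-bodyWords n (λ {j} _ → word≢2 (n + n) j))

metaString-text : ∀ n → metaString Fin._≟_ (length (reference (n + n))) (text n)
  ≡ Parsing.LZ Fin._≟_ (reference (n + n)) ++ bodyWords n
metaString-text n = trans
  (cong₂ (λ R W → Parsing.LZ Fin._≟_ R ++ Parsing.RLZ Fin._≟_ W R)
    (take-length-++ R) (trans (cong (λ ℓ → drop ℓ (text n)) (sym (+-identityʳ (length R)))) (drop-length-++ R 0)))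
  (cong (Parsing.LZ Fin._≟_ R ++_) (RLZ-body n))
  where
  R : String
  R = reference (n + n)

-- The form `j + 0` makes this definitionally the image of the offset pair 0, d in `lineWords`.
wordPair : ℕ → ℕ → ℕ → List String
wordPair n j d = word (n + n) (j + 0) ∷ word (n + n) (j + d) ∷ []

wordPair-injective : ∀ n {j k d e} → wordPair n j d ≡ wordPair n k e → j ≡ k × d ≡ e
wordPair-injective n {j} {k} eq
  with refl ← +-cancelʳ-≡ 0 j k (word-injective (n + n) (∷-injectiveˡ eq))
  = refl , +-cancelˡ-≡ j _ _ (word-injective (n + n) (∷-injectiveˡ (∷-injectiveʳ eq)))

wordPair⊑bodyWords : ∀ n {j d} → j < suc n → d < suc n → Infix _≡_ (wordPair n j d) (bodyWords n)
wordPair⊑bodyWords n {j} {d} j<1+n d<1+n = Infix.trans trans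
  (Infix.map⁺ _ _ (Infix.map (cong (λ d → word (n + n) (j + d)))
    (infix-concat (∈-applyUpTo⁺ (λ d → 0 ∷ d ∷ []) d<1+n))))
  (infix-concat (∈-applyUpTo⁺ (lineWords n) j<1+n))

prefixLength : ℕ → ℕ
prefixLength n = length (reference (n + n))

ẑ-text≥ : ∀ n → suc n * suc n ≤ ẑ (prefixLength n) (text n)
ẑ-text≥ n = begin
  suc n * suc n       ≡⟨ cong₂ _*_ (sym (length-upTo (suc n))) (sym (length-upTo (suc n))) ⟩
  length (upTo (suc n)) * length (upTo (suc n))
    ≡⟨ sym (length-cartesianProductWith (wordPair n) (upTo (suc n)) (upTo (suc n))) ⟩
  length (cartesianProductWith (wordPair n) (upTo (suc n)) (upTo (suc n)))
    ≤⟨ bigrams≤LZ (≡-dec Fin._≟_) _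
         (cartesianProductWith⁺ (wordPair n) (wordPair-injective n) (upTo⁺ (suc n)) (upTo⁺ (suc n))) occurs ⟩
  length (Parsing.LZ (≡-dec Fin._≟_) S) ≡⟨ sym (length-map concat (Parsing.LZ (≡-dec Fin._≟_) S)) ⟩
  ẑ (prefixLength n) (text n) ∎
  where
  open ≤-Reasoning
  S : List String
  S = metaString Fin._≟_ (prefixLength n) (text n)
  occurs : ∀ {g} → g ∈ cartesianProductWith (wordPair n) (upTo (suc n)) (upTo (suc n)) → _
  occurs g∈ with j , d , j∈ , d∈ , refl ← ∈-cartesianProductWith⁻ (wordPair n) (upTo (suc n)) (upTo (suc n)) g∈
    -- The phrases of the reference are only prepended, so the bigrams of `bodyWords` survive
    -- whatever these phrases are.
    = infix⇒bigram (≡-dec Fin._≟_) (subst (Infix _≡_ (wordPair n j d)) (sym (metaString-text n))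
        (Parsing.LZ Fin._≟_ (reference (n + n)) ++ⁱ wordPair⊑bodyWords n (∈-upTo⁻ j∈) (∈-upTo⁻ d∈)))

-- Injectivity of the family and asymptotics.

-- The text begins with `1F`, then `n + n` zeros, then `2F`, so its first run of zeros determines
-- `n`.
text-injective : Injective _≡_ _≡_ text
text-injective {n} {k} eq = double-injective (run-injective (n + n) (k + k) {y = 2F} {z = 2F} (λ ()) (λ ())
  (trans (sym (tail n)) (trans (∷-injectiveʳ eq) (tail k))))
  where
  rest : ℕ → String
  rest n = concat (map (_∷ʳ 2F) (applyUpTo (word (n + n) ∘ suc) (n + n)))
  tail : ∀ n → ((replicate (n + n) 0F ∷ʳ 2F) ++ rest n) ++ body n ≡ replicate (n + n) 0F ++ 2F ∷ rest n ++ body n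
  tail n = trans (++-assoc (replicate (n + n) 0F ∷ʳ 2F) (rest n) (body n)) (∷ʳ-++ (replicate (n + n) 0F) 2F _)
  double-injective : ∀ {n k} → n + n ≡ k + k → n ≡ k
  double-injective {zero}  {zero}  _  = refl
  double-injective {suc n} {suc k} eq = cong suc (double-injective
    (suc-injective (suc-injective (trans (cong suc (sym (+-suc n n))) (trans eq (cong suc (+-suc k k)))))))

prefixLength≤ : ∀ n → prefixLength n ≤ length (text n)
prefixLength≤ n = length-++-≤ˡ (reference (n + n))

length-text : ∀ n → length (text n) ≡ 2 * suc n * suc (n + n) * (2 + n)
length-text n = trans (length-++ (reference (n + n)))
  (trans (cong₂ _+_ (length-reference (n + n)) (length-body n)) (identity n))
  where
  identity : ∀ n → suc (n + n) * suc (suc (n + n)) + suc n * (suc n * 2) * suc (n + n)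
    ≡ 2 * suc n * suc (n + n) * (2 + n)
  identity = solve-∀

1+n≤2^n : ∀ n → suc n ≤ 2 ^ n
1+n≤2^n zero    = ≤-refl
1+n≤2^n (suc n) = begin
  suc (suc n)         ≤⟨ s≤s (m≤n+m (suc n) n) ⟩
  suc n + suc n       ≤⟨ +-mono-≤ (1+n≤2^n n) (1+n≤2^n n) ⟩
  2 ^ n + 2 ^ n       ≡⟨ cong (2 ^ n +_) (sym (+-identityʳ (2 ^ n))) ⟩
  2 ^ suc n           ∎
  where open ≤-Reasoning

-- A crude logarithm bound, log of the length at most 3K with K = n + 1: it suffices because `ẑ` is
-- at least quadratic and `z` at most linear in K.
length-text≤ : ∀ n → length (text n) ≤ 2 ^ (3 * suc n)
length-text≤ n = begin
  length (text n)                        ≡⟨ length-text n ⟩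
  2 * suc n * suc (n + n) * (2 + n)      ≤⟨ *-mono-≤ (*-monoʳ-≤ (2 * suc n) 1+2n≤) 2+n≤ ⟩
  2 * suc n * (2 * suc n) * (2 * suc n)  ≤⟨ *-mono-≤ (*-mono-≤ 2K≤ 2K≤) 2K≤ ⟩
  2 ^ suc n * 2 ^ suc n * 2 ^ suc n      ≡⟨ cong (_* 2 ^ suc n) (sym (^-distribˡ-+-* 2 (suc n) (suc n))) ⟩
  2 ^ (suc n + suc n) * 2 ^ suc n        ≡⟨ sym (^-distribˡ-+-* 2 (suc n + suc n) (suc n)) ⟩
  2 ^ (suc n + suc n + suc n)            ≡⟨ cong (2 ^_) (identity (suc n)) ⟩
  2 ^ (3 * suc n)                        ∎
  where
  open ≤-Reasoning
  2K≤ : 2 * suc n ≤ 2 ^ suc n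
  2K≤ = *-monoʳ-≤ 2 (1+n≤2^n n)
  double : ∀ n → 2 * suc n ≡ suc (suc (n + n))
  double = solve-∀
  1+2n≤ : suc (n + n) ≤ 2 * suc n
  1+2n≤ = ≤-trans (n≤1+n _) (≤-reflexive (sym (double n)))
  2+n≤ : 2 + n ≤ 2 * suc n
  2+n≤ = ≤-trans (s≤s (s≤s (m≤m+n n n))) (≤-reflexive (sym (double n)))
  identity : ∀ k → k + k + k ≡ 3 * k
  identity = solve-∀

prefixLength-littleO : IsLittleOLength text prefixLength
-- By `length-text≤`, a text this long forces `2 * k ≤ suc n`.
prefixLength-littleO k = 2 ^ (3 * (2 * k)) , bound
  where
  open ≤-Reasoning
  identity₁ : ∀ k n → k * (suc (n + n) * suc (suc (n + n))) ≡ (2 * k) * (suc n * suc (n + n))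
  identity₁ = solve-∀
  identity₂ : ∀ n → suc n * (suc n * 2) * suc (n + n) ≡ suc n * (suc n * suc (n + n)) + suc n * (suc n * suc (n + n))
  identity₂ = solve-∀
  bound : ∀ n → 2 ^ (3 * (2 * k)) ≤ length (text n) → k * prefixLength n ≤ length (text n)
  bound n N≤ with 2 * k ≤? suc n
  ... | yes 2k≤K = begin
    k * prefixLength n                               ≡⟨ cong (k *_) (length-reference (n + n)) ⟩
    k * (suc (n + n) * suc (suc (n + n)))            ≡⟨ identity₁ k n ⟩
    -- The body has length 2K times K(2n + 1), so it alone dominates 2k times K(2n + 1).
    (2 * k) * (suc n * suc (n + n))                  ≤⟨ *-monoˡ-≤ (suc n * suc (n + n)) 2k≤K ⟩
    suc n * (suc n * suc (n + n))                    ≤⟨ m≤m+n _ (suc n * (suc n * suc (n + n))) ⟩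
    suc n * (suc n * suc (n + n)) + suc n * (suc n * suc (n + n)) ≡⟨ sym (identity₂ n) ⟩
    suc n * (suc n * 2) * suc (n + n)                ≡⟨ sym (length-body n) ⟩
    length (body n)                                  ≤⟨ m≤n+m (length (body n)) (prefixLength n) ⟩
    prefixLength n + length (body n)                 ≡⟨ sym (length-++ (reference (n + n))) ⟩
    length (text n)                                  ∎
  ... | no 2k≰K = contradiction (begin-strict
    length (text n)      ≤⟨ length-text≤ n ⟩
    2 ^ (3 * suc n)      <⟨ ^-monoʳ-< 2 (s<s z<s) (*-monoʳ-< 3 (≰⇒> 2k≰K)) ⟩
    2 ^ (3 * (2 * k))    ≤⟨ N≤ ⟩
    length (text n)      ∎) (<-irrefl refl)

ẑ-text-bigOmega : IsBigOmegaTimesLog text (λ n → ẑ (prefixLength n) (text n)) (λ n → z (text n))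
-- Here 36 is 3 times 12, from log of the length at most 3K and `z` at most 12K, against `ẑ` at
-- least K squared. The estimate holds for every `n`, so the threshold is 0.
ẑ-text-bigOmega = 36 , z<s , 0 , λ n _ → begin
  length (text n) ^ z (text n)         ≤⟨ ^-monoˡ-≤ (z (text n)) (length-text≤ n) ⟩
  (2 ^ (3 * suc n)) ^ z (text n)       ≡⟨ ^-*-assoc 2 (3 * suc n) (z (text n)) ⟩
  2 ^ (3 * suc n * z (text n))         ≤⟨ ^-monoʳ-≤ 2 (*-monoʳ-≤ (3 * suc n) (z≤12K n)) ⟩
  2 ^ (3 * suc n * (12 * suc n))       ≡⟨ cong (2 ^_) (identity₂ (suc n)) ⟩
  2 ^ (36 * (suc n * suc n))           ≤⟨ ^-monoʳ-≤ 2 (*-monoʳ-≤ 36 (ẑ-text≥ n)) ⟩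
  2 ^ (36 * ẑ (prefixLength n) (text n)) ∎
  where
  open ≤-Reasoning
  -- The encoding has 12n + 4 phrases; 8 more round this up to a multiple of `suc n`.
  identity₁ : ∀ n → 2 + (n + n) + (n + n) * 3 + (suc n * 2 + n * 2) + 8 ≡ 12 * suc n
  identity₁ = solve-∀
  identity₂ : ∀ k → 3 * k * (12 * k) ≡ 36 * (k * k)
  identity₂ = solve-∀
  z≤12K : ∀ n → z (text n) ≤ 12 * suc n
  z≤12K n = ≤-trans (z-text≤ n) (≤-trans (m≤m+n _ 8) (≤-reflexive (identity₁ n)))

-- Injectivity of `T` expresses that the family is infinite.
theorem2 : Σ[ T ∈ (ℕ → String) ] Σ[ ℓ ∈ (ℕ → ℕ) ]
    ( Injective _≡_ _≡_ T
    × (∀ i → ℓ i ≤ length (T i))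
    × IsLittleOLength T ℓ
    × IsBigOmegaTimesLog T (λ i → ẑ (ℓ i) (T i)) (λ i → z (T i)))
theorem2 = text , prefixLength , text-injective , prefixLength≤ , prefixLength-littleO , ẑ-text-bigOmega
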